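{- Let $k\ge 2$ and $d\ge 1$ be integers. For the online (integral) matching problem on $k$-uniform hypergraphs under vertex arrivals, restricted to instances in which every online node has degree at most $d$, the competitive ratio of the algorithm RANDOM is at least $$\min\left(\frac{1}{k-1},\ \frac{d}{(d-1)k+1}\right).$$ That is, for every such instance $\mathcal H$, the expected size of the matching produced by RANDOM is at least $\min\left(\frac{1}{k-1},\frac{d}{(d-1)k+1}\right)\cdot \mathsf{OPT}(\mathcal H)$.
   Context: An instance is a finite $k$-uniform hypergraph $\mathcal H=(V,W,H)$ with offline nodes $V$, a finite sequence $W$ of online nodes, and hyperedges $H$, each containing exactly one node of $W$ and exactly $k-1$ nodes of $V$. The online nodes arrive one by one in the order of $W$; when $w$ arrives, the set $\delta(w)$ of hyperedges containing $w$ is revealed. The degree of $w$ is $|\delta(w)|$. A matching is a set of pairwise disjoint hyperedges, and $\mathsf{OPT}(\mathcal H)$ is the maximum size of a matching in $\mathcal H$. Algorithm RANDOM maintains a matching $\mathcal M$, initially empty. When an online node $w$ arrives, it considers the hyperedges of $\delta(w)$ that are disjoint from all hyperedges currently in $\mathcal M$; if there is at least one, it picks one of them uniformly at random (with fresh independent randomness) and adds it to $\mathcal M$; otherwise it does nothing. Its output is the final $\mathcal M$. The instance is fixed independently of the random choices. -}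

module Defs where

open import Data.Fin using (Fin)
import Data.Fin as Fin
open import Data.Fin.Subset using (Subset; ∣_∣; Empty; _∩_)
open import Data.Fin.Subset.Properties using (nonempty?)
open import Data.Integer using (+_)
open import Data.List using (List; []; _∷_; _++_; map; filter; length; lookup; allFin)
open import Data.List.Extrema.Nat using (max)
open import Data.List.Relation.Unary.All using (All; all?)
open import Data.List.Relation.Unary.AllPairs using (AllPairs; allPairs?)
open import Data.List.Relation.Unary.Unique.Propositional using (Unique)
open import Data.Nat using (ℕ; suc; _∸_; _≤_; >-nonZero)
import Data.Nat as ℕ
open import Data.Nat.Properties using (m<n⇒0<n∸m)
open import Data.Product using (_×_)
open import Data.Rational using (ℚ; _/_; _*_; _⊓_; +-0-rawMonoid)
open import Algebra.Definitions.RawMonoid +-0-rawMonoid using (sum)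
open import Relation.Binary.Definitions using (Decidable)
open import Relation.Binary.PropositionalEquality using (_≡_; _≢_)
import Relation.Unary as U
open import Relation.Nullary.Decidable using (¬?; _×-dec_)

fromℕ : ℕ → ℚ
fromℕ n = + n / 1

-- Hyperedges over the offline nodes Fin n and the online nodes Fin m: having
-- exactly one online node is built into the representation.
record Hyperedge (n m : ℕ) : Set where
  constructor edge
  field
    online  : Fin m
    offline : Subset n

open Hyperedge public

Disjoint : ∀ {n m} → Hyperedge n m → Hyperedge n m → Set
Disjoint e f = online e ≢ online f × Empty (offline e ∩ offline f)

disjoint? : ∀ {n m} → Decidable (Disjoint {n} {m})
disjoint? e f =
  ¬? (online e Fin.≟ online f) ×-dec ¬? (nonempty? (offline e ∩ offline f))

-- The online nodes arrive in the order 0, 1, …, #W - 1 of Fin #W.  The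
-- hyperedge set is a duplicate-free list.
record Instance (k : ℕ) : Set where
  field
    #V #W     : ℕ
    H         : List (Hyperedge #V #W)
    H-unique  : Unique H
    H-uniform : All (λ e → suc ∣ offline e ∣ ≡ k) H

  δ : Fin #W → List (Hyperedge #V #W)
  δ w = filter (λ e → online e Fin.≟ w) H

  degree : Fin #W → ℕ
  degree w = length (δ w)

-- Sets of hyperedges are lists; since no hyperedge is disjoint from itself
-- (it shares its own online node), a matching has no repetitions.
IsMatching : ∀ {n m} → List (Hyperedge n m) → Set
IsMatching = AllPairs Disjoint

isMatching? : ∀ {n m} → U.Decidable (IsMatching {n} {m})
isMatching? = allPairs? disjoint?

-- Applied to a duplicate-free list, this enumerates every subset exactly once.
sublists : ∀ {A : Set} → List A → List (List A)
sublists []       = [] ∷ []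
sublists (x ∷ xs) = sublists xs ++ map (x ∷_) (sublists xs)

-- The default value 0 of max is harmless: the empty set is a matching.
OPT : ∀ {k} → Instance k → ℕ
OPT ℋ = max 0 (map length (filter isMatching? (sublists (Instance.H ℋ))))

-- Finite randomised computations: `uniform n t` draws a fresh uniform i in
-- Fin (suc n), independent of all earlier draws, and continues with t i.
data Rand (A : Set) : Set where
  return  : A → Rand A
  uniform : (n : ℕ) → (Fin (suc n) → Rand A) → Rand A

infixl 1 _>>=_

_>>=_ : ∀ {A B : Set} → Rand A → (A → Rand B) → Rand B
return a    >>= f = f a
uniform n t >>= f = uniform n (λ i → t i >>= f)

𝔼 : ∀ {A : Set} → (A → ℚ) → Rand A → ℚ
𝔼 X (return a)    = X a
𝔼 X (uniform n t) = (+ 1 / suc n) * sum (λ i → 𝔼 X (t i))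

module _ {k : ℕ} (ℋ : Instance k) where
  open Instance ℋ

  private
    Edges : Set
    Edges = List (Hyperedge #V #W)

  available : Fin #W → Edges → Edges
  available w M = filter (λ e → all? (disjoint? e) M) (δ w)

  addRandom : Edges → Edges → Rand Edges
  addRandom []       M = return M
  addRandom (e ∷ es) M =
    uniform (length es) (λ i → return (lookup (e ∷ es) i ∷ M))

  process : List (Fin #W) → Edges → Rand Edges
  process []       M = return M
  process (w ∷ ws) M = addRandom (available w M) M >>= process ws

  RANDOM : Rand Edges
  RANDOM = process (allFin #W) []

-- For d ≥ 1 the truncated d ∸ 1 is the true d - 1.
ratio : (k d : ℕ) → 2 ≤ k → ℚ
ratio k d 2≤k =
  _/_ (+ 1) (k ∸ 1) {{>-nonZero (m<n⇒0<n∸m 2≤k)}}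
    ⊓ (+ d / suc ((d ∸ 1) ℕ.* k))

{-# OPTIONS --safe #-}

-- Charging argument.  Let x be the ratio and y = 1 - (k - 1) x ≥ 0.  Each
-- hyperedge chosen by RANDOM pays x to each of its offline nodes and y to its
-- online node, hence at most 1 in total to the members of a fixed matching O.
-- A hyperedge o ∈ O blocked at the arrival of its online node w has received
-- x through a shared offline node.  If instead o is one of a ≤ d available
-- hyperedges, it is chosen with probability 1 / a, receiving 1, and receives
-- at least y through w otherwise; (1 + (a - 1) y) / a ≥ x is equivalent to
-- x ≤ a / ((a - 1) k + 1), whose right-hand side decreases in a.  So every
-- o ∈ O receives at least x in expectation.
module Submission where

open import Defs
open import Data.Nat using (ℕ; _≤_)
open import Data.List using (length)
import Data.Rational as ℚ

open import Algebra.Definitions.RawMonoid ℚ.+-0-rawMonoid using (sum)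
open import Data.Fin using (Fin; zero; suc)
import Data.Fin as Fin
open import Data.Fin.Subset using (Subset; inside; outside; ∣_∣; _∩_; _─_; Empty; Nonempty)
open import Data.Fin.Subset.Properties using
  (nonempty?; p⊆q⇒∣p∣≤∣q∣; x∈p⇒∣p-x∣<∣p∣; x∈p∩q⁺; x∈p∩q⁻; x∈p∧x∉q⇒x∈p─q; ∩-idem; ∩-comm)
open import Data.Integer using (+_)
import Data.Integer as ℤ
import Data.Integer.Properties as ℤ
open import Data.List using (List; []; _∷_; map; lookup; allFin)
open import Data.List.Extrema.Nat using (argmax-all)
open import Data.List.Membership.Propositional using (_∈_; find)
open import Data.List.Membership.Propositional.Properties
  using (∈-filter⁺; ∈-filter⁻; ∈-lookup; ∈-++⁻; ∈-map⁻; ∈-allFin)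
open import Data.List.Properties using (length-filter)
import Data.List.Relation.Unary.All as All
open import Data.List.Relation.Unary.All using (All; []; _∷_; all?)
open import Data.List.Relation.Unary.All.Properties using (¬All⇒Any¬; map⁺)
open import Data.List.Relation.Unary.AllPairs using ([]; _∷_)
import Data.List.Relation.Unary.Any as Any
open import Data.List.Relation.Unary.Any using (here; there)
open import Data.List.Relation.Unary.Any.Properties using (lookup-index)
open import Data.Nat using (zero; suc; _+_; _*_; _∸_; z≤n; s≤s)
import Data.Nat.ListAction as ℕ
import Data.Nat.Properties as ℕ
open import Data.Nat.Solver using (module +-*-Solver)
open import Data.Product using (_×_; _,_; proj₁; proj₂)
open import Data.Rational using (ℚ; 0ℚ; 1ℚ; _/_; nonNegative)
import Data.Rational.Properties as ℚ
import Data.Rational.Solver as ℚ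
open import Data.Rational.Unnormalised using (mkℚᵘ; *≡*)
import Data.Rational.Unnormalised as ℚᵘ
import Data.Rational.Unnormalised.Properties as ℚᵘ
open import Data.Sum using (inj₁; inj₂)
open import Data.Vec using ([]; _∷_)
open import Function using (_∘_)
open import Relation.Binary.PropositionalEquality using
  (_≡_; _≢_; refl; sym; trans; cong; cong₂; subst; module ≡-Reasoning)
open import Relation.Nullary using (yes; no; contradiction)
open import Algebra.Properties.CommutativeMonoid.Sum ℚ.+-0-commutativeMonoid
  using (sum-cong-≗; ∑-distrib-+; sum-remove; sum-replicate-zero)

private variable
  A : Set
  n : ℕ

-- Rational arithmetic

-- Division in `ℚ` normalises by a gcd, which is stuck on variables. Passing to unnormalised
-- fractions turns equations about `fromℕ` and `_/_` into cross-multiplication over the integers.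
fromℚᵘ-homo-+ : ∀ p q → ℚ.fromℚᵘ p ℚ.+ ℚ.fromℚᵘ q ≡ ℚ.fromℚᵘ (p ℚᵘ.+ q)
fromℚᵘ-homo-+ p q = ℚ.toℚᵘ-injective
  (ℚᵘ.≃-trans (ℚ.toℚᵘ-homo-+ (ℚ.fromℚᵘ p) (ℚ.fromℚᵘ q))
  (ℚᵘ.≃-trans (ℚᵘ.+-cong (ℚ.toℚᵘ-fromℚᵘ p) (ℚ.toℚᵘ-fromℚᵘ q))
  (ℚᵘ.≃-sym (ℚ.toℚᵘ-fromℚᵘ (p ℚᵘ.+ q)))))

fromℚᵘ-homo-* : ∀ p q → ℚ.fromℚᵘ p ℚ.* ℚ.fromℚᵘ q ≡ ℚ.fromℚᵘ (p ℚᵘ.* q)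
fromℚᵘ-homo-* p q = ℚ.toℚᵘ-injective
  (ℚᵘ.≃-trans (ℚ.toℚᵘ-homo-* (ℚ.fromℚᵘ p) (ℚ.fromℚᵘ q))
  (ℚᵘ.≃-trans (ℚᵘ.*-cong (ℚ.toℚᵘ-fromℚᵘ p) (ℚ.toℚᵘ-fromℚᵘ q))
  (ℚᵘ.≃-sym (ℚ.toℚᵘ-fromℚᵘ (p ℚᵘ.* q)))))

fromℕ-+ : ∀ m n → fromℕ (m + n) ≡ fromℕ m ℚ.+ fromℕ n
fromℕ-+ m n = sym (trans (fromℚᵘ-homo-+ (mkℚᵘ (+ m) 0) (mkℚᵘ (+ n) 0))
  (ℚ.fromℚᵘ-cong {mkℚᵘ (+ m) 0 ℚᵘ.+ mkℚᵘ (+ n) 0} {mkℚᵘ (+ (m + n)) 0} (*≡* (cong (ℤ._* + 1)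
    (cong₂ ℤ._+_ (ℤ.*-identityʳ (+ m)) (ℤ.*-identityʳ (+ n)))))))

fromℕ-* : ∀ m n → fromℕ (m * n) ≡ fromℕ m ℚ.* fromℕ n
fromℕ-* m n = sym (trans (fromℚᵘ-homo-* (mkℚᵘ (+ m) 0) (mkℚᵘ (+ n) 0))
  (ℚ.fromℚᵘ-cong {mkℚᵘ (+ m) 0 ℚᵘ.* mkℚᵘ (+ n) 0} {mkℚᵘ (+ (m * n)) 0}
    (*≡* (cong (ℤ._* + 1) (sym (ℤ.pos-* m n))))))

/-*-fromℕ : ∀ m n → (+ m / suc n) ℚ.* fromℕ (suc n) ≡ fromℕ m
/-*-fromℕ m n = trans (fromℚᵘ-homo-* (mkℚᵘ (+ m) n) (mkℚᵘ (+ suc n) 0))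
  (ℚ.fromℚᵘ-cong {mkℚᵘ (+ m) n ℚᵘ.* mkℚᵘ (+ suc n) 0} {mkℚᵘ (+ m) 0}
    (*≡* (trans (ℤ.*-identityʳ (+ m ℤ.* + suc n))
    (cong (+ m ℤ.*_) (cong +_ (sym (ℕ.*-identityʳ (suc n))))))))

0≤/ : ∀ m n → 0ℚ ℚ.≤ (+ m / suc n)
0≤/ m n = ℚ.nonNegative⁻¹ (+ m / suc n) {{ℚ.normalize-nonNeg m (suc n)}}

0≤fromℕ : ∀ n → 0ℚ ℚ.≤ fromℕ n
0≤fromℕ n = 0≤/ n 0

fromℕ-mono : ∀ {m n} → m ≤ n → fromℕ m ℚ.≤ fromℕ n
fromℕ-mono {m} {n} m≤n = begin
  fromℕ m                        ≡⟨ ℚ.+-identityʳ (fromℕ m) ⟨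
  fromℕ m ℚ.+ 0ℚ                 ≤⟨ ℚ.+-monoʳ-≤ (fromℕ m) (0≤fromℕ (n ∸ m)) ⟩
  fromℕ m ℚ.+ fromℕ (n ∸ m)      ≡⟨ fromℕ-+ m (n ∸ m) ⟨
  fromℕ (m + (n ∸ m))            ≡⟨ cong fromℕ (ℕ.m+[n∸m]≡n m≤n) ⟩
  fromℕ n                        ∎
  where open ℚ.≤-Reasoning

*-monoˡ : ∀ {p q} r → 0ℚ ℚ.≤ r → p ℚ.≤ q → r ℚ.* p ℚ.≤ r ℚ.* q
*-monoˡ r 0≤r = ℚ.*-monoˡ-≤-nonNeg r {{nonNegative 0≤r}}

*-monoʳ : ∀ {p q} r → 0ℚ ℚ.≤ r → p ℚ.≤ q → p ℚ.* r ℚ.≤ q ℚ.* r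
*-monoʳ r 0≤r = ℚ.*-monoʳ-≤-nonNeg r {{nonNegative 0≤r}}

0≤fromℕ* : ∀ n {p} → 0ℚ ℚ.≤ p → 0ℚ ℚ.≤ fromℕ n ℚ.* p
0≤fromℕ* n {p} 0≤p = subst (ℚ._≤ fromℕ n ℚ.* p) (ℚ.*-zeroʳ (fromℕ n)) (*-monoˡ (fromℕ n) (0≤fromℕ n) 0≤p)

+-nonNeg : ∀ {p q} → 0ℚ ℚ.≤ p → 0ℚ ℚ.≤ q → 0ℚ ℚ.≤ p ℚ.+ q
+-nonNeg = ℚ.+-mono-≤

fromℕ-suc-* : ∀ n p → fromℕ (suc n) ℚ.* p ≡ p ℚ.+ fromℕ n ℚ.* p
fromℕ-suc-* n p = begin
  fromℕ (suc n) ℚ.* p              ≡⟨ cong (ℚ._* p) (fromℕ-+ 1 n) ⟩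
  (1ℚ ℚ.+ fromℕ n) ℚ.* p           ≡⟨ ℚ.*-distribʳ-+ p 1ℚ (fromℕ n) ⟩
  1ℚ ℚ.* p ℚ.+ fromℕ n ℚ.* p       ≡⟨ cong (ℚ._+ fromℕ n ℚ.* p) (ℚ.*-identityˡ p) ⟩
  p ℚ.+ fromℕ n ℚ.* p              ∎
  where open ≡-Reasoning

sum-mono : ∀ {n} {f g : Fin n → ℚ} → (∀ i → f i ℚ.≤ g i) → sum f ℚ.≤ sum g
sum-mono {zero}  f≤g = ℚ.≤-refl
sum-mono {suc n} f≤g = ℚ.+-mono-≤ (f≤g zero) (sum-mono (f≤g ∘ suc))

sum-lower : ∀ {n} {f : Fin n → ℚ} {c} → (∀ i → c ℚ.≤ f i) → fromℕ n ℚ.* c ℚ.≤ sum f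
sum-lower {zero}      {c = c} c≤f = ℚ.≤-reflexive (ℚ.*-zeroˡ c)
sum-lower {suc n} {f} {c}     c≤f =
  subst (ℚ._≤ sum f) (sym (fromℕ-suc-* n c))
    (ℚ.+-mono-≤ (c≤f zero) (sum-lower (c≤f ∘ suc)))

-- Meant for a uniform draw with one favourable outcome: `sum-remove` splits off index `i`, and
-- `punchIn i` runs over the other `n`.
sum-lower-at : ∀ {n} {f : Fin (suc n) → ℚ} {b c} i → b ℚ.≤ f i → (∀ j → c ℚ.≤ f j) →
  b ℚ.+ fromℕ n ℚ.* c ℚ.≤ sum f
sum-lower-at {f = f} i b≤fi c≤f =
  subst (_ ℚ.≤_) (sym (sum-remove {i = i} f)) (ℚ.+-mono-≤ b≤fi (sum-lower (c≤f ∘ Fin.punchIn i)))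

mean-lower : ∀ n {c s} → fromℕ (suc n) ℚ.* c ℚ.≤ s → c ℚ.≤ (+ 1 / suc n) ℚ.* s
mean-lower n {c} {s} nc≤s = begin
  c                                             ≡⟨ ℚ.*-identityˡ c ⟨
  1ℚ ℚ.* c                                      ≡⟨ cong (ℚ._* c) (/-*-fromℕ 1 n) ⟨
  (+ 1 / suc n) ℚ.* fromℕ (suc n) ℚ.* c         ≡⟨ ℚ.*-assoc (+ 1 / suc n) (fromℕ (suc n)) c ⟩
  (+ 1 / suc n) ℚ.* (fromℕ (suc n) ℚ.* c)       ≤⟨ *-monoˡ (+ 1 / suc n) (0≤/ 1 n) nc≤s ⟩
  (+ 1 / suc n) ℚ.* s                           ∎
  where open ℚ.≤-Reasoning

total : (A → ℚ) → List A → ℚ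
total f []       = 0ℚ
total f (a ∷ as) = f a ℚ.+ total f as

total-+ : ∀ (f g : A → ℚ) as → total (λ a → f a ℚ.+ g a) as ≡ total f as ℚ.+ total g as
total-+ f g []       = refl
total-+ f g (a ∷ as) rewrite total-+ f g as =
  solve 4 (λ p q r s → (p :+ q) :+ (r :+ s) := (p :+ r) :+ (q :+ s)) refl
    (f a) (g a) (total f as) (total g as)
  where open ℚ.+-*-Solver

total-0 : ∀ (as : List A) → total (λ _ → 0ℚ) as ≡ 0ℚ
total-0 []       = refl
total-0 (a ∷ as) = trans (ℚ.+-identityˡ _) (total-0 as)

-- Taking out the rate `c` leaves a count in `ℕ`, which the disjointness of a matching can bound.
total-fromℕ-* : ∀ (f : A → ℕ) c as →
  total (λ a → fromℕ (f a) ℚ.* c) as ≡ fromℕ (ℕ.sum (map f as)) ℚ.* c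
total-fromℕ-* f c []       = sym (ℚ.*-zeroˡ c)
total-fromℕ-* f c (a ∷ as) = begin
  fromℕ (f a) ℚ.* c ℚ.+ total (λ a → fromℕ (f a) ℚ.* c) as
    ≡⟨ cong (fromℕ (f a) ℚ.* c ℚ.+_) (total-fromℕ-* f c as) ⟩
  fromℕ (f a) ℚ.* c ℚ.+ fromℕ (ℕ.sum (map f as)) ℚ.* c
    ≡⟨ ℚ.*-distribʳ-+ c (fromℕ (f a)) _ ⟨
  (fromℕ (f a) ℚ.+ fromℕ (ℕ.sum (map f as))) ℚ.* c
    ≡⟨ cong (ℚ._* c) (fromℕ-+ (f a) _) ⟨
  fromℕ (ℕ.sum (map f (a ∷ as))) ℚ.* c ∎
  where open ≡-Reasoning

total-nonNeg : ∀ {f : A → ℚ} → (∀ a → 0ℚ ℚ.≤ f a) → ∀ as → 0ℚ ℚ.≤ total f as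
total-nonNeg 0≤f []       = ℚ.≤-refl
total-nonNeg 0≤f (a ∷ as) = +-nonNeg (0≤f a) (total-nonNeg 0≤f as)

≤-total : ∀ {f : A → ℚ} → (∀ a → 0ℚ ℚ.≤ f a) → ∀ {a as} → a ∈ as → f a ℚ.≤ total f as
≤-total {f = f} 0≤f {a} {_ ∷ as} (here refl) =
  subst (ℚ._≤ total f (a ∷ as)) (ℚ.+-identityʳ (f a)) (ℚ.+-monoʳ-≤ (f a) (total-nonNeg 0≤f as))
≤-total {f = f} 0≤f {a} {b ∷ as} (there a∈as) =
  subst (ℚ._≤ total f (b ∷ as)) (ℚ.+-identityˡ (f a)) (ℚ.+-mono-≤ (0≤f b) (≤-total 0≤f a∈as))

total-lower : ∀ {f : A → ℚ} {c as} → (∀ {a} → a ∈ as → c ℚ.≤ f a) →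
  c ℚ.* fromℕ (length as) ℚ.≤ total f as
total-lower {c = c} {[]} c≤f = ℚ.≤-reflexive (ℚ.*-zeroʳ c)
total-lower {f = f} {c} {a ∷ as} c≤f = subst (ℚ._≤ total f (a ∷ as))
  (sym (trans (ℚ.*-comm c _) (trans (fromℕ-suc-* (length as) c) (cong (c ℚ.+_) (ℚ.*-comm _ c)))))
  (ℚ.+-mono-≤ (c≤f (here refl)) (total-lower (c≤f ∘ there)))

-- Expectations

-- Comparing credits with the size of the output uses that all chosen hyperedges lie in `H`, so the
-- comparison is available only on outcomes that actually occur. This predicate records such facts,
-- and `𝔼-mono` consumes them.
Always : (A → Set) → Rand A → Set
Always P (return a)    = P a
Always P (uniform n t) = ∀ i → Always P (t i)

𝔼-mono : ∀ {X Y : A → ℚ} r → Always (λ a → X a ℚ.≤ Y a) r → 𝔼 X r ℚ.≤ 𝔼 Y r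
𝔼-mono (return a)    X≤Y = X≤Y
𝔼-mono (uniform n t) X≤Y =
  *-monoˡ (+ 1 / suc n) (0≤/ 1 n) (sum-mono (λ i → 𝔼-mono (t i) (X≤Y i)))

Always-map : ∀ {P Q : A → Set} → (∀ {a} → P a → Q a) → ∀ r → Always P r → Always Q r
Always-map P⇒Q (return a)    p = P⇒Q p
Always-map P⇒Q (uniform n t) p = λ i → Always-map P⇒Q (t i) (p i)

𝔼-0 : ∀ (r : Rand A) → 𝔼 (λ _ → 0ℚ) r ≡ 0ℚ
𝔼-0 (return a)    = refl
𝔼-0 (uniform n t) = trans (cong ((+ 1 / suc n) ℚ.*_)
  (trans (sum-cong-≗ (𝔼-0 ∘ t)) (sum-replicate-zero (suc n)))) (ℚ.*-zeroʳ (+ 1 / suc n))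

𝔼-+ : ∀ (X Y : A → ℚ) r → 𝔼 (λ a → X a ℚ.+ Y a) r ≡ 𝔼 X r ℚ.+ 𝔼 Y r
𝔼-+ X Y (return a)    = refl
𝔼-+ X Y (uniform n t) = trans (cong ((+ 1 / suc n) ℚ.*_)
  (trans (sum-cong-≗ (λ i → 𝔼-+ X Y (t i))) (∑-distrib-+ (𝔼 X ∘ t) (𝔼 Y ∘ t))))
  (ℚ.*-distribˡ-+ (+ 1 / suc n) _ _)

𝔼-total : ∀ {B : Set} (X : B → A → ℚ) bs r →
  𝔼 (λ a → total (λ b → X b a) bs) r ≡ total (λ b → 𝔼 (X b) r) bs
𝔼-total X []       r = 𝔼-0 r
𝔼-total X (b ∷ bs) r = trans (𝔼-+ (X b) _ r) (cong (𝔼 (X b) r ℚ.+_) (𝔼-total X bs r))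

𝔼-uniform-lower : ∀ {n c} {X : A → ℚ} (t : Fin (suc n) → Rand A) →
  (∀ i → c ℚ.≤ 𝔼 X (t i)) → c ℚ.≤ 𝔼 X (uniform n t)
𝔼-uniform-lower {n = n} t c≤ = mean-lower n (sum-lower c≤)

-- Counting in matchings

∣p∩q∣+∣p─q∣≡∣p∣ : ∀ (p q : Subset n) → ∣ p ∩ q ∣ + ∣ p ─ q ∣ ≡ ∣ p ∣
∣p∩q∣+∣p─q∣≡∣p∣ []            []            = refl
∣p∩q∣+∣p─q∣≡∣p∣ (outside ∷ p) (outside ∷ q) = ∣p∩q∣+∣p─q∣≡∣p∣ p q
∣p∩q∣+∣p─q∣≡∣p∣ (outside ∷ p) (inside  ∷ q) = ∣p∩q∣+∣p─q∣≡∣p∣ p q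
∣p∩q∣+∣p─q∣≡∣p∣ (inside  ∷ p) (outside ∷ q) =
  trans (ℕ.+-suc ∣ p ∩ q ∣ ∣ p ─ q ∣) (cong suc (∣p∩q∣+∣p─q∣≡∣p∣ p q))
∣p∩q∣+∣p─q∣≡∣p∣ (inside  ∷ p) (inside  ∷ q) = cong suc (∣p∩q∣+∣p─q∣≡∣p∣ p q)

∣p∩r∣≤∣p─q∩r∣ : ∀ (p : Subset n) {q r} → Empty (q ∩ r) → ∣ p ∩ r ∣ ≤ ∣ (p ─ q) ∩ r ∣
∣p∩r∣≤∣p─q∩r∣ p {q} {r} q∩r≡∅ = p⊆q⇒∣p∣≤∣q∣ λ {i} i∈p∩r →
  let i∈p , i∈r = x∈p∩q⁻ p r i∈p∩r in
  x∈p∩q⁺ (x∈p∧x∉q⇒x∈p─q i∈p (λ i∈q → q∩r≡∅ (i , x∈p∩q⁺ (i∈q , i∈r))) , i∈r)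

Nonempty⇒0<∣p∣ : ∀ {p : Subset n} → Nonempty p → 1 ≤ ∣ p ∣
Nonempty⇒0<∣p∣ (i , i∈p) = ℕ.≤-trans (s≤s z≤n) (x∈p⇒∣p-x∣<∣p∣ i∈p)

module _ {v m : ℕ} where

  private
    E : Set
    E = Hyperedge v m

  -- The offline parts of `O` are disjoint, so their traces on `p` do not overlap. The induction
  -- deletes `offline o` from `p`, which takes nothing from the later traces; hence `p` must stay
  -- arbitrary.
  sum-overlap≤∣p∣ : ∀ {O : List E} → IsMatching O → ∀ p →
    ℕ.sum (map (λ o → ∣ p ∩ offline o ∣) O) ≤ ∣ p ∣
  sum-overlap≤∣p∣ []                       p = z≤n
  sum-overlap≤∣p∣ {o ∷ O} (o-dis ∷ O-dis) p = begin
    ∣ p ∩ offline o ∣ + ℕ.sum (map (λ o → ∣ p ∩ offline o ∣) O)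
      ≤⟨ ℕ.+-monoʳ-≤ ∣ p ∩ offline o ∣ (shrink o-dis) ⟩
    ∣ p ∩ offline o ∣ + ℕ.sum (map (λ o′ → ∣ (p ─ offline o) ∩ offline o′ ∣) O)
      ≤⟨ ℕ.+-monoʳ-≤ ∣ p ∩ offline o ∣ (sum-overlap≤∣p∣ O-dis (p ─ offline o)) ⟩
    ∣ p ∩ offline o ∣ + ∣ p ─ offline o ∣
      ≡⟨ ∣p∩q∣+∣p─q∣≡∣p∣ p (offline o) ⟩
    ∣ p ∣ ∎
    where
    open ℕ.≤-Reasoning
    shrink : ∀ {O} → All (Disjoint o) O →
      ℕ.sum (map (λ o → ∣ p ∩ offline o ∣) O) ≤
      ℕ.sum (map (λ o′ → ∣ (p ─ offline o) ∩ offline o′ ∣) O)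
    shrink []                  = z≤n
    shrink ((_ , q∩r≡∅) ∷ dis) = ℕ.+-mono-≤ (∣p∩r∣≤∣p─q∩r∣ p q∩r≡∅) (shrink dis)

  -- The indicator takes values in `ℕ` so that online payments are counted in the same way as
  -- offline overlaps.
  sameOnline : E → E → ℕ
  sameOnline e o with online e Fin.≟ online o
  ... | yes _ = 1
  ... | no  _ = 0

  sameOnline-≡ : ∀ {e o} → online e ≡ online o → sameOnline e o ≡ 1
  sameOnline-≡ {e} {o} e≡o with online e Fin.≟ online o
  ... | yes _  = refl
  ... | no e≢o = contradiction e≡o e≢o

  -- The online nodes of a matching are distinct, so after the first hit all later terms vanish.
  sum-sameOnline≤1 : ∀ {O : List E} → IsMatching O → ∀ e → ℕ.sum (map (sameOnline e) O) ≤ 1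
  sum-sameOnline≤1 []                       e = z≤n
  sum-sameOnline≤1 {o ∷ O} (o-dis ∷ O-dis) e with online e Fin.≟ online o
  ... | no  _   = sum-sameOnline≤1 O-dis e
  ... | yes e≡o = ℕ.≤-reflexive (cong suc (vanish o-dis))
    where
    vanish : ∀ {O} → All (Disjoint o) O → ℕ.sum (map (sameOnline e) O) ≡ 0
    vanish [] = refl
    vanish {o′ ∷ _} ((o≢o′ , _) ∷ dis) with online e Fin.≟ online o′
    ... | yes e≡o′ = contradiction (trans (sym e≡o) e≡o′) o≢o′
    ... | no  _    = vanish dis

-- `OPT` ranges over sublists of `H`; this places the members of the competing matchings in `H`.
∈-sublists⁻ : ∀ {xs ys : List A} {z} → ys ∈ sublists xs → z ∈ ys → z ∈ xs
∈-sublists⁻ {xs = []}     (here refl) ()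
∈-sublists⁻ {xs = x ∷ xs} ys∈ z∈ys with ∈-++⁻ (sublists xs) ys∈
... | inj₁ ys∈xs = there (∈-sublists⁻ ys∈xs z∈ys)
... | inj₂ ys∈map with ∈-map⁻ (x ∷_) ys∈map
...   | ys′ , ys′∈ , refl with z∈ys
...     | here refl  = here refl
...     | there z∈ys′ = there (∈-sublists⁻ ys′∈ z∈ys′)

-- The charging scheme

-- `K` is k - 1. `balance` gives each hyperedge exactly 1 to distribute over its nodes; `choice a`
-- is the inequality for `suc a` available hyperedges, multiplied through by their number.
module Charging {K d : ℕ} (ℋ : Instance (suc K))
  (deg : ∀ w → Instance.degree ℋ w ≤ d)
  {x y : ℚ} (0≤x : 0ℚ ℚ.≤ x) (0≤y : 0ℚ ℚ.≤ y)
  (balance : fromℕ K ℚ.* x ℚ.+ y ≡ 1ℚ)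
  (choice : ∀ a → suc a ≤ d → fromℕ (suc a) ℚ.* x ℚ.≤ 1ℚ ℚ.+ fromℕ a ℚ.* y)
  where

  open Instance ℋ

  private
    E : Set
    E = Hyperedge #V #W

  ∣offline∣≡K : ∀ {e} → e ∈ H → ∣ offline e ∣ ≡ K
  ∣offline∣≡K e∈H = ℕ.suc-injective (All.lookup H-uniform e∈H)

  -- What e pays to o.
  share : E → E → ℚ
  share o e = fromℕ ∣ offline e ∩ offline o ∣ ℚ.* x ℚ.+ fromℕ (sameOnline e o) ℚ.* y

  credit : E → List E → ℚ
  credit o = total (share o)

  0≤share : ∀ o e → 0ℚ ℚ.≤ share o e
  0≤share o e = +-nonNeg (0≤fromℕ* ∣ offline e ∩ offline o ∣ 0≤x) (0≤fromℕ* (sameOnline e o) 0≤y)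

  credit-∷ : ∀ o e M → credit o M ℚ.≤ credit o (e ∷ M)
  credit-∷ o e M = subst (ℚ._≤ credit o (e ∷ M)) (ℚ.+-identityˡ _) (ℚ.+-monoˡ-≤ _ (0≤share o e))

  share≤credit : ∀ o e M → share o e ℚ.≤ credit o (e ∷ M)
  share≤credit o e M = ≤-total {f = share o} (0≤share o) {e} {e ∷ M} (here refl)

  -- A hyperedge meets itself in all `K` offline nodes and in its online node, so it collects the
  -- full budget of `balance`.
  share-self : ∀ {o} → o ∈ H → share o o ≡ 1ℚ
  share-self {o} o∈H
    rewrite ∩-idem (offline o) | ∣offline∣≡K o∈H | sameOnline-≡ {e = o} {o = o} refl =
    trans (cong (fromℕ K ℚ.* x ℚ.+_) (ℚ.*-identityˡ y)) balance

  y≤share : ∀ o e → online e ≡ online o → y ℚ.≤ share o e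
  y≤share o e e≡o rewrite sameOnline-≡ {e = e} {o = o} e≡o = begin
    y                    ≡⟨ ℚ.*-identityˡ y ⟨
    1ℚ ℚ.* y             ≡⟨ ℚ.+-identityˡ _ ⟨
    0ℚ ℚ.+ 1ℚ ℚ.* y      ≤⟨ ℚ.+-monoˡ-≤ (1ℚ ℚ.* y) (0≤fromℕ* ∣ offline e ∩ offline o ∣ 0≤x) ⟩
    fromℕ ∣ offline e ∩ offline o ∣ ℚ.* x ℚ.+ 1ℚ ℚ.* y ∎
    where open ℚ.≤-Reasoning

  x≤share : ∀ o e → Nonempty (offline e ∩ offline o) → x ℚ.≤ share o e
  x≤share o e ne = begin
    x                    ≡⟨ ℚ.*-identityˡ x ⟨
    1ℚ ℚ.* x             ≤⟨ *-monoʳ x 0≤x (fromℕ-mono (Nonempty⇒0<∣p∣ ne)) ⟩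
    fromℕ ∣ offline e ∩ offline o ∣ ℚ.* x
                         ≡⟨ ℚ.+-identityʳ _ ⟨
    fromℕ ∣ offline e ∩ offline o ∣ ℚ.* x ℚ.+ 0ℚ
                         ≤⟨ ℚ.+-monoʳ-≤ (fromℕ ∣ offline e ∩ offline o ∣ ℚ.* x) (0≤fromℕ* (sameOnline e o) 0≤y) ⟩
    share o e            ∎
    where open ℚ.≤-Reasoning

  -- Members of `O` share no node, so together they collect each of the `K` offline payments and the
  -- online payment of `e` at most once.
  total-share≤1 : ∀ {O} → IsMatching O → ∀ {e} → e ∈ H → total (λ o → share o e) O ℚ.≤ 1ℚ
  total-share≤1 {O} O-matching {e} e∈H = begin
    total (λ o → share o e) O
      ≡⟨ total-+ (λ o → fromℕ ∣ offline e ∩ offline o ∣ ℚ.* x) _ O ⟩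
    total (λ o → fromℕ ∣ offline e ∩ offline o ∣ ℚ.* x) O ℚ.+
    total (λ o → fromℕ (sameOnline e o) ℚ.* y) O
      ≡⟨ cong₂ ℚ._+_ (total-fromℕ-* (λ o → ∣ offline e ∩ offline o ∣) x O)
                     (total-fromℕ-* (sameOnline e) y O) ⟩
    fromℕ (ℕ.sum (map (λ o → ∣ offline e ∩ offline o ∣) O)) ℚ.* x ℚ.+
    fromℕ (ℕ.sum (map (sameOnline e) O)) ℚ.* y
      ≤⟨ ℚ.+-mono-≤
           (*-monoʳ x 0≤x (fromℕ-mono (sum-overlap≤∣p∣ O-matching (offline e))))
           (*-monoʳ y 0≤y (fromℕ-mono (sum-sameOnline≤1 O-matching e))) ⟩
    fromℕ ∣ offline e ∣ ℚ.* x ℚ.+ 1ℚ ℚ.* y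
      ≡⟨ cong₂ ℚ._+_ (cong (λ j → fromℕ j ℚ.* x) (∣offline∣≡K e∈H)) (ℚ.*-identityˡ y) ⟩
    fromℕ K ℚ.* x ℚ.+ y
      ≡⟨ balance ⟩
    1ℚ ∎
    where open ℚ.≤-Reasoning

  total-credit≤length : ∀ {O} → IsMatching O → ∀ {M} → All (_∈ H) M →
    total (λ o → credit o M) O ℚ.≤ fromℕ (length M)
  total-credit≤length {O} O-matching [] = ℚ.≤-reflexive (total-0 O)
  total-credit≤length {O} O-matching {e ∷ M} (e∈H ∷ M⊆H) = begin
    total (λ o → share o e ℚ.+ credit o M) O
      ≡⟨ total-+ (λ o → share o e) (λ o → credit o M) O ⟩
    total (λ o → share o e) O ℚ.+ total (λ o → credit o M) O
      ≤⟨ ℚ.+-mono-≤ (total-share≤1 O-matching e∈H) (total-credit≤length O-matching M⊆H) ⟩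
    1ℚ ℚ.+ fromℕ (length M)
      ≡⟨ fromℕ-+ 1 (length M) ⟨
    fromℕ (length (e ∷ M)) ∎
    where open ℚ.≤-Reasoning

  ∈-available⁻ : ∀ {e} w M → e ∈ available ℋ w M → e ∈ H × online e ≡ w
  ∈-available⁻ w M e∈ =
    ∈-filter⁻ (λ e → online e Fin.≟ w) (proj₁ (∈-filter⁻ (λ e → all? (disjoint? e) M) e∈))

  ∣available∣≤d : ∀ w M → length (available ℋ w M) ≤ d
  ∣available∣≤d w M = ℕ.≤-trans (length-filter (λ e → all? (disjoint? e) M) (δ w)) (deg w)

  process⊆H : ∀ ws M → All (_∈ H) M → Always (All (_∈ H)) (process ℋ ws M)
  process⊆H []       M M⊆H = M⊆H
  process⊆H (w ∷ ws) M M⊆H = go (available ℋ w M) (proj₁ ∘ ∈-available⁻ w M)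
    where
    -- `addRandom` branches on the list of available hyperedges, so that list is generalised to
    -- `es`.
    go : ∀ es → (∀ {e} → e ∈ es → e ∈ H) →
      Always (All (_∈ H)) (addRandom ℋ es M >>= process ℋ ws)
    go []       _    = process⊆H ws M M⊆H
    go (e ∷ es) es⊆H = λ i → process⊆H ws _ (es⊆H (∈-lookup {xs = e ∷ es} i) ∷ M⊆H)

  -- A bound that holds after every possible outcome survives averaging, whatever the probabilities.
  -- It serves at arrivals where the worst outcome is already good enough.
  addRandom-lower : ∀ {X c} ws es M → c ℚ.≤ 𝔼 X (process ℋ ws M) →
    (∀ {e} → e ∈ es → c ℚ.≤ 𝔼 X (process ℋ ws (e ∷ M))) →
    c ℚ.≤ 𝔼 X (addRandom ℋ es M >>= process ℋ ws)
  addRandom-lower     ws []       M c≤ _   = c≤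
  addRandom-lower {X} ws (e ∷ es) M _  c≤∷ =
    𝔼-uniform-lower {X = X} (λ i → process ℋ ws (lookup (e ∷ es) i ∷ M))
      (λ i → c≤∷ (∈-lookup {xs = e ∷ es} i))

  -- Hyperedges are never discarded and shares are nonnegative, so credit never falls along a run. A
  -- payment can therefore be counted at the moment it is made.
  credit≤𝔼credit : ∀ o ws M → credit o M ℚ.≤ 𝔼 (credit o) (process ℋ ws M)
  credit≤𝔼credit o []       M = ℚ.≤-refl
  credit≤𝔼credit o (w ∷ ws) M = addRandom-lower ws (available ℋ w M) M
    (credit≤𝔼credit o ws M)
    (λ {e} _ → ℚ.≤-trans (credit-∷ o e M) (credit≤𝔼credit o ws (e ∷ M)))

  x≤𝔼credit-available : ∀ {o} → o ∈ H → ∀ ws es M → o ∈ es → length es ≤ d →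
    (∀ {e} → e ∈ es → online e ≡ online o) →
    x ℚ.≤ 𝔼 (credit o) (addRandom ℋ es M >>= process ℋ ws)
  x≤𝔼credit-available {o} o∈H ws (e ∷ es) M o∈es ∣es∣≤d es-online =
    -- With a = `length es`, one of the a + 1 equally likely outcomes is `o`, earning at least 1,
    -- and each of the other a earns at least `y`; `choice` compares the sum with (a + 1) x.
    mean-lower (length es) (ℚ.≤-trans (choice (length es) ∣es∣≤d)
      (sum-lower-at (Any.index o∈es) 1≤ y≤))
    where
    1≤ : 1ℚ ℚ.≤ 𝔼 (credit o) (process ℋ ws (lookup (e ∷ es) (Any.index o∈es) ∷ M))
    1≤ = subst (λ e → 1ℚ ℚ.≤ 𝔼 (credit o) (process ℋ ws (e ∷ M))) (lookup-index o∈es)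
      (ℚ.≤-trans (ℚ.≤-reflexive (sym (share-self o∈H)))
        (ℚ.≤-trans (share≤credit o o M) (credit≤𝔼credit o ws (o ∷ M))))
    y≤ : ∀ i → y ℚ.≤ 𝔼 (credit o) (process ℋ ws (lookup (e ∷ es) i ∷ M))
    y≤ i = ℚ.≤-trans (y≤share o eᵢ (es-online (∈-lookup {xs = e ∷ es} i)))
      (ℚ.≤-trans (share≤credit o eᵢ M) (credit≤𝔼credit o ws (eᵢ ∷ M)))
      where eᵢ = lookup (e ∷ es) i

  x≤𝔼credit-arrival : ∀ {o} → o ∈ H → ∀ ws M → All (λ e → online e ≢ online o) M →
    x ℚ.≤ 𝔼 (credit o) (process ℋ (online o ∷ ws) M)
  x≤𝔼credit-arrival {o} o∈H ws M M≢o with all? (disjoint? o) M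
  ... | yes o-free = x≤𝔼credit-available o∈H ws (available ℋ (online o) M) M
    (∈-filter⁺ (λ e → all? (disjoint? e) M)
      (∈-filter⁺ (λ e → online e Fin.≟ online o) o∈H refl) o-free)
    (∣available∣≤d (online o) M) (proj₂ ∘ ∈-available⁻ (online o) M)
  ... | no ¬o-free with find (¬All⇒Any¬ (disjoint? o) M ¬o-free)
  -- `M≢o` excludes a common online node, so the blocking hyperedge `e` shares an offline node with
  -- `o`; the `x` it has already paid survives the rest of the run.
  ...   | e , e∈M , ¬dis with nonempty? (offline o ∩ offline e)
  ...     | no  empty = contradiction (All.lookup M≢o e∈M ∘ sym , empty) ¬dis
  ...     | yes ne    = ℚ.≤-trans (x≤share o e (subst Nonempty (∩-comm (offline o) (offline e)) ne))
    (ℚ.≤-trans (≤-total {f = share o} (0≤share o) e∈M) (credit≤𝔼credit o (online o ∷ ws) M))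

  -- Before `online o` arrives, every hyperedge added contains another online node, so the condition
  -- on `M` persists until `x≤𝔼credit-arrival` applies.
  x≤𝔼credit : ∀ {o} → o ∈ H → ∀ ws M → online o ∈ ws → All (λ e → online e ≢ online o) M →
    x ℚ.≤ 𝔼 (credit o) (process ℋ ws M)
  x≤𝔼credit o∈H (_ ∷ ws) M (here refl) M≢o = x≤𝔼credit-arrival o∈H ws M M≢o
  x≤𝔼credit {o} o∈H (w ∷ ws) M (there o∈ws) M≢o with w Fin.≟ online o
  -- `ws` may repeat nodes, so `online o` can already be the node arriving here.
  ... | yes refl = x≤𝔼credit-arrival o∈H ws M M≢o
  ... | no  w≢o  = addRandom-lower ws (available ℋ w M) M
    (x≤𝔼credit o∈H ws M o∈ws M≢o)
    (λ e∈ → x≤𝔼credit o∈H ws _ o∈ws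
      ((λ e≡o → w≢o (trans (sym (proj₂ (∈-available⁻ w M e∈))) e≡o)) ∷ M≢o))

  -- Exchanging the sum over `O` with the expectation leaves a bound on each single outcome, where
  -- `total-credit≤length` applies by `process⊆H`.
  x*matching≤𝔼 : ∀ {O} → IsMatching O → (∀ {o} → o ∈ O → o ∈ H) →
    x ℚ.* fromℕ (length O) ℚ.≤ 𝔼 (fromℕ ∘ length) (RANDOM ℋ)
  x*matching≤𝔼 {O} O-matching O⊆H = begin
    x ℚ.* fromℕ (length O)
      ≤⟨ total-lower (λ {o} o∈O → x≤𝔼credit (O⊆H o∈O) (allFin #W) [] (∈-allFin (online o)) []) ⟩
    total (λ o → 𝔼 (credit o) (RANDOM ℋ)) O
      ≡⟨ 𝔼-total credit O (RANDOM ℋ) ⟨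
    𝔼 (λ M → total (λ o → credit o M) O) (RANDOM ℋ)
      ≤⟨ 𝔼-mono (RANDOM ℋ) (Always-map (λ {M} → total-credit≤length O-matching {M}) (RANDOM ℋ)
           (process⊆H (allFin #W) [] [])) ⟩
    𝔼 (fromℕ ∘ length) (RANDOM ℋ) ∎
    where open ℚ.≤-Reasoning

  x*OPT≤𝔼 : x ℚ.* fromℕ (OPT ℋ) ℚ.≤ 𝔼 (fromℕ ∘ length) (RANDOM ℋ)
  x*OPT≤𝔼 = argmax-all (λ j → j)
    {P = λ j → x ℚ.* fromℕ j ℚ.≤ 𝔼 (fromℕ ∘ length) (RANDOM ℋ)}
    -- The default value 0 of the maximum is the size of the empty matching.
    (x*matching≤𝔼 [] λ ())
    (map⁺ (All.tabulate λ O∈ →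
      let O∈sub , O-matching = ∈-filter⁻ isMatching? O∈ in
      x*matching≤𝔼 O-matching (∈-sublists⁻ O∈sub)))

-- The choice of x

-- q ↦ q / ((q - 1) k + 1) is decreasing, at q = a + 1 ≤ d + 1 with k + 1 for k.
ratio-antitone : ∀ k a d → a ≤ d → suc d * suc (a * suc k) ≤ suc a * suc (d * suc k)
ratio-antitone k a d a≤d = subst (λ d → suc d * suc (a * suc k) ≤ suc a * suc (d * suc k))
  (ℕ.m+[n∸m]≡n a≤d) (ℕ.≤-trans (ℕ.m≤m+n _ ((d ∸ a) * k)) (ℕ.≤-reflexive (identity (d ∸ a))))
  where
  open +-*-Solver
  -- The two sides of the inequality differ by exactly (d - a) k; writing d = a + t makes this a
  -- polynomial identity over `ℕ` without subtraction.
  identity : ∀ t → suc (a + t) * suc (a * suc k) + t * k ≡ suc a * suc ((a + t) * suc k)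
  identity t = solve 3 (λ k a t →
    (con 1 :+ (a :+ t)) :* (con 1 :+ a :* (con 1 :+ k)) :+ t :* k :=
    (con 1 :+ a) :* (con 1 :+ (a :+ t) :* (con 1 :+ k))) refl k a t

-- Here the degree bound is `suc d` and the uniformity is `suc K`, so `x≤` is the second bound of
-- the minimum cleared of its denominator.
module _ {K d : ℕ} {x : ℚ} (0≤x : 0ℚ ℚ.≤ x)
  (x≤ : x ℚ.* fromℕ (suc (d * suc K)) ℚ.≤ fromℕ (suc d)) where

  -- After multiplication by `suc d`, `ratio-antitone` reduces the claim to `x≤`: the largest number
  -- of available hyperedges gives the tightest constraint on `x`.
  x*⟨ak+1⟩≤a+1 : ∀ {a} → a ≤ d → x ℚ.* fromℕ (suc (a * suc K)) ℚ.≤ fromℕ (suc a)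
  x*⟨ak+1⟩≤a+1 {a} a≤d = ℚ.*-cancelʳ-≤-pos (fromℕ (suc d)) {{ℚ.normalize-pos (suc d) 1}} (begin
    x ℚ.* fromℕ (suc (a * suc K)) ℚ.* fromℕ (suc d)
      ≡⟨ ℚ.*-assoc x (fromℕ (suc (a * suc K))) (fromℕ (suc d)) ⟩
    x ℚ.* (fromℕ (suc (a * suc K)) ℚ.* fromℕ (suc d))
      ≡⟨ cong (x ℚ.*_) (trans (ℚ.*-comm (fromℕ (suc (a * suc K))) (fromℕ (suc d))) (sym (fromℕ-* (suc d) (suc (a * suc K))))) ⟩
    x ℚ.* fromℕ (suc d * suc (a * suc K))
      ≤⟨ *-monoˡ x 0≤x (fromℕ-mono (ratio-antitone K a d a≤d)) ⟩
    x ℚ.* fromℕ (suc a * suc (d * suc K))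
      ≡⟨ cong (x ℚ.*_) (trans (fromℕ-* (suc a) (suc (d * suc K))) (ℚ.*-comm (fromℕ (suc a)) (fromℕ (suc (d * suc K))))) ⟩
    x ℚ.* (fromℕ (suc (d * suc K)) ℚ.* fromℕ (suc a))
      ≡⟨ ℚ.*-assoc x (fromℕ (suc (d * suc K))) (fromℕ (suc a)) ⟨
    x ℚ.* fromℕ (suc (d * suc K)) ℚ.* fromℕ (suc a)
      ≤⟨ *-monoʳ (fromℕ (suc a)) (0≤fromℕ (suc a)) x≤ ⟩
    fromℕ (suc d) ℚ.* fromℕ (suc a)
      ≡⟨ ℚ.*-comm (fromℕ (suc d)) (fromℕ (suc a)) ⟩
    fromℕ (suc a) ℚ.* fromℕ (suc d) ∎)
    where open ℚ.≤-Reasoning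

  -- With y = 1 - K x, moving a K x to the left gives (a + 1) x + a K x = (a k + 1) x with k = K +
  -- 1, which is at most a + 1.
  choice-bound : ∀ a → suc a ≤ suc d →
    fromℕ (suc a) ℚ.* x ℚ.≤ 1ℚ ℚ.+ fromℕ a ℚ.* (1ℚ ℚ.- fromℕ K ℚ.* x)
  choice-bound a (s≤s a≤d) = begin
    fromℕ (suc a) ℚ.* x
      ≡⟨ cong (ℚ._* x) (fromℕ-+ 1 a) ⟩
    (1ℚ ℚ.+ α) ℚ.* x
      ≡⟨ solve 3 (λ x α κ → (con 1ℚ :+ α) :* x :=
           x :* (con 1ℚ :+ α :* (con 1ℚ :+ κ)) :- α :* (κ :* x)) refl x α κ ⟩
    x ℚ.* (1ℚ ℚ.+ α ℚ.* (1ℚ ℚ.+ κ)) ℚ.- α ℚ.* (κ ℚ.* x)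
      ≡⟨ cong (λ z → x ℚ.* z ℚ.- α ℚ.* (κ ℚ.* x)) expand ⟨
    x ℚ.* fromℕ (suc (a * suc K)) ℚ.- α ℚ.* (κ ℚ.* x)
      ≤⟨ ℚ.+-monoˡ-≤ _ (x*⟨ak+1⟩≤a+1 a≤d) ⟩
    fromℕ (suc a) ℚ.- α ℚ.* (κ ℚ.* x)
      ≡⟨ cong (ℚ._- α ℚ.* (κ ℚ.* x)) (fromℕ-+ 1 a) ⟩
    1ℚ ℚ.+ α ℚ.- α ℚ.* (κ ℚ.* x)
      ≡⟨ solve 3 (λ x α κ → con 1ℚ :+ α :- α :* (κ :* x) :=
           con 1ℚ :+ α :* (con 1ℚ :- κ :* x)) refl x α κ ⟩
    1ℚ ℚ.+ α ℚ.* (1ℚ ℚ.- κ ℚ.* x) ∎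
    where
    open ℚ.≤-Reasoning
    open ℚ.+-*-Solver
    α = fromℕ a
    κ = fromℕ K
    expand : fromℕ (suc (a * suc K)) ≡ 1ℚ ℚ.+ α ℚ.* (1ℚ ℚ.+ κ)
    expand = trans (fromℕ-+ 1 (a * suc K)) (cong (1ℚ ℚ.+_)
      (trans (fromℕ-* a (suc K)) (cong (α ℚ.*_) (fromℕ-+ 1 K))))

≤/⇒*fromℕ≤ : ∀ {x} m n → x ℚ.≤ (+ m / suc n) → x ℚ.* fromℕ (suc n) ℚ.≤ fromℕ m
≤/⇒*fromℕ≤ {x} m n x≤ =
  subst (x ℚ.* fromℕ (suc n) ℚ.≤_) (/-*-fromℕ m n) (*-monoʳ (fromℕ (suc n)) (0≤fromℕ (suc n)) x≤)

theorem1p2 : (k d : ℕ) (2≤k : 2 ≤ k) → 1 ≤ d →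
    (ℋ : Instance k) → (∀ w → Instance.degree ℋ w ≤ d) →
    ratio k d 2≤k ℚ.* fromℕ (OPT ℋ) ℚ.≤ 𝔼 (λ M → fromℕ (length M)) (RANDOM ℋ)
theorem1p2 (suc zero) _ (s≤s ())
-- Matching `d` as `suc D` reduces the truncated `d ∸ 1` to `D`, and `K` as `suc J` exposes a
-- nonzero denominator in 1 / (k - 1).
theorem1p2 k@(suc K@(suc J)) (suc D) 2≤k 1≤d ℋ deg =
  Charging.x*OPT≤𝔼 ℋ deg 0≤x 0≤y balance
    (choice-bound 0≤x (≤/⇒*fromℕ≤ (suc D) (D * k) (ℚ.p⊓q≤q (+ 1 / K) (+ suc D / suc (D * k)))))
  where
  x = ratio k (suc D) 2≤k
  -- What remains of 1 after `K` offline payments. The first argument of the minimum keeps it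
  -- nonnegative; the second supplies `choice-bound`.
  y = 1ℚ ℚ.- fromℕ K ℚ.* x
  0≤x : 0ℚ ℚ.≤ x
  0≤x = ℚ.⊓-glb {0ℚ} {+ 1 / K} {+ suc D / suc (D * k)} (0≤/ 1 J) (0≤/ (suc D) (D * k))
  Kx≤1 : fromℕ K ℚ.* x ℚ.≤ 1ℚ
  Kx≤1 = subst (ℚ._≤ 1ℚ) (ℚ.*-comm x (fromℕ K)) (≤/⇒*fromℕ≤ 1 J (ℚ.p⊓q≤p (+ 1 / K) (+ suc D / suc (D * k))))
  0≤y : 0ℚ ℚ.≤ y
  0≤y = subst (ℚ._≤ y) (ℚ.+-inverseʳ (fromℕ K ℚ.* x)) (ℚ.+-monoˡ-≤ (ℚ.- (fromℕ K ℚ.* x)) Kx≤1)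
  balance : fromℕ K ℚ.* x ℚ.+ y ≡ 1ℚ
  balance = ℚ.+-*-Solver.solve 1 (λ z → z :+ (con 1ℚ :- z) := con 1ℚ) refl (fromℕ K ℚ.* x)
    where open ℚ.+-*-Solver
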